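{- For every integer $m\ge 2$ there exists a color complete $m$-pole.
   Context: An $m$-pole ($m\ge 1$), or multipole, $M=(V,E,\mathcal{E})$ consists of a finite set $V$ of vertices, a finite collection $E$ of edges (unordered pairs of vertices; parallel edges and loops may occur), and a set $\mathcal{E}=\{\epsilon_1,\dots,\epsilon_m\}$ of $m$ semiedges. Each semiedge is either incident to exactly one vertex, or is paired with another semiedge to form a free (isolated) edge, which has no vertices. All multipoles are cubic: for each vertex, the number of edges (loops counted twice) plus semiedges incident to it is $3$. A multipole may be disconnected, and $V$ may be empty. A Tait coloring of $M$ is a map $\phi:E\cup\mathcal{E}\to\{1,2,3\}$ such that the three edges/semiedges incident with any vertex receive distinct colors (so a multipole with a loop has none) and the two semiedges of any free edge receive the same color. A state of $M$ is a tuple $(\phi(\epsilon_1),\dots,\phi(\epsilon_m))$ with $\phi$ a Tait coloring of $M$. A tuple in $\{1,2,3\}^m$ is admissible if, with $m_i$ the number of entries equal to $i$, $m_1\equiv m_2\equiv m_3\equiv m\pmod 2$. (By the Parity Lemma every state is admissible.) $M$ is color complete if every admissible tuple is a state of $M$. -}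

module Defs where

open import Data.Fin using (Fin)
open import Data.Fin.Properties using (_≟_)
open import Data.Nat using (ℕ)
open import Data.Nat.DivMod using (_%_)
open import Data.Product using (_×_; _,_; proj₁; proj₂; ∃; ∃-syntax)
open import Data.Sum using (_⊎_; inj₁; inj₂)
open import Data.Vec using (Vec; tabulate; count)
open import Function.Bundles using (_↔_)
open import Function.Definitions using (Injective)
open import Relation.Binary.PropositionalEquality using (_≡_; _≢_)

Finite : Set → Set
Finite A = ∃[ n ] (A ↔ Fin n)

record Multipole (m : ℕ) : Set₁ where
  field
    V        : Set
    E        : Set
    V-finite : Finite V
    E-finite : Finite E

    -- The order of the two ends carries no meaning: nothing below depends on it.
    -- Parallel edges are distinct elements of E with the same ends.
    ends     : E → V × V

    -- inj₁ v: the semiedge is incident to v;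
    -- inj₂ j: it forms a free edge together with the semiedge j.
    attach   : Fin m → V ⊎ Fin m
    paired   : ∀ {i j} → attach i ≡ inj₂ j → i ≢ j × attach j ≡ inj₂ i

  -- The edge ends and semiedges at v. A loop at v occurs in both of the first
  -- two summands, so it is counted twice.
  IncidentAt : V → Set
  IncidentAt v = (∃[ e ] proj₁ (ends e) ≡ v)
               ⊎ (∃[ e ] proj₂ (ends e) ≡ v)
               ⊎ (∃[ i ] attach i ≡ inj₁ v)

  field
    cubic    : ∀ v → IncidentAt v ↔ Fin 3

Color : Set
Color = Fin 3

module _ {m : ℕ} (M : Multipole m) where
  open Multipole M

  colorAt : (E → Color) → (Fin m → Color) → ∀ v → IncidentAt v → Color
  colorAt φᴱ φˢ v (inj₁ (e , _))        = φᴱ e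
  colorAt φᴱ φˢ v (inj₂ (inj₁ (e , _))) = φᴱ e
  colorAt φᴱ φˢ v (inj₂ (inj₂ (i , _))) = φˢ i

  record TaitColoring : Set where
    field
      φᴱ     : E → Color
      φˢ     : Fin m → Color
      proper : ∀ v → Injective _≡_ _≡_ (colorAt φᴱ φˢ v)
      free   : ∀ {i j} → attach i ≡ inj₂ j → φˢ i ≡ φˢ j

  IsState : Vec Color m → Set
  IsState t = ∃[ φ ] tabulate (TaitColoring.φˢ φ) ≡ t

Admissible : ∀ {m} → Vec Color m → Set
Admissible {m} t = ∀ (c : Color) → count (_≟ c) t % 2 ≡ m % 2

ColorComplete : ∀ {m} → Multipole m → Set
ColorComplete M = ∀ t → Admissible t → IsState M t

{-# OPTIONS --safe #-}
-- Induction on m: two semiedges p, q of a color complete pole are replaced by three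
-- semiedges d, e, c.  A path of three vertices with end vertices {p, a, x}, {q, c, y} and
-- middle vertex {x, b, y} has, for given a, b, c, a coloring with p + q = a + b + c in the
-- Klein four-group, unless a = c ≠ b.  A 4-cycle with semiedges a, d, b, e in cyclic order
-- admits both (a , b) = (d , e) and (a , b) = (e , d), for all colors d, e, so attaching it
-- to a and b avoids the exceptional case.
module Submission where

open import Data.Bool using (Bool; true; false)
open import Data.Fin using (Fin; zero; suc; punchIn; _↑ˡ_; _↑ʳ_)
open import Data.Fin.Patterns using (0F; 1F; 2F; 3F)
open import Data.Fin.Permutation using (insert; insert-punchIn; _⟨$⟩ʳ_)
open import Data.Fin.Properties using (_≟_; all?; any?)
open import Data.Nat using (ℕ; zero; suc; _+_; _≤_; _<_; z≤n; s≤s; z<s; s<s)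
open import Data.Nat.DivMod using (_%_; m%n<n)
open import Data.Nat.GeneralisedArithmetic using (fold)
open import Data.Product using (_×_; _,_; proj₁; proj₂; ∃-syntax)
open import Data.Sum using (_⊎_; inj₁; inj₂)
open import Data.Sum.Function.Propositional using (_⊎-↔_)
open import Data.Sum.Properties using (inj₁-injective)
open import Data.Unit using (⊤)
open import Data.Vec using (Vec; []; _∷_; lookup; insertAt; count; foldr′)
open import Data.Vec.Properties using (insertAt-lookup; insertAt-punchIn; tabulate∘lookup)
open import Level using (0ℓ)
open import Function using (_∘_)
open import Function.Bundles using (_↔_; mk↔ₛ′; Inverse)
open import Function.Construct.Composition using (_↔-∘_)
open import Function.Construct.Identity using (↔-id)
open import Function.Definitions using (Injective)
open import Relation.Binary.PropositionalEquality
  using (_≡_; _≢_; refl; sym; trans; cong; module ≡-Reasoning)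
open import Relation.Nullary using (Dec; yes; contradiction; ¬?)
open import Relation.Nullary.Decidable using (from-yes; _×-dec_; _→-dec_)
open import Relation.Unary using (Pred)
open import Defs

open Inverse using (to; from; strictlyInverseˡ; strictlyInverseʳ)

private
  variable
    m : ℕ

-- Poles built from half-edges, and their states.

Slot : ℕ → ℕ → Set
Slot e m = Fin e × Bool ⊎ Fin m

-- A multipole without free edges; cubicity is built into the type of place.
record Pole (m : ℕ) : Set where
  field
    vertices edges : ℕ
    place          : Slot edges m ↔ (Fin vertices × Fin 3)

-- Colors sit on vertex corners rather than on edges, so joining or reordering semiedges keeps
-- `color` unchanged and only rearranges the equations.
record State (M : Pole m) (t : Vec Color m) : Set where
  open Pole M
  field
    color    : Fin vertices × Fin 3 → Color
    distinct : ∀ v → Injective _≡_ _≡_ (λ k → color (v , k))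
    edge     : ∀ e → color (to place (inj₁ (e , false))) ≡ color (to place (inj₁ (e , true)))
    semiedge : ∀ i → color (to place (inj₂ i)) ≡ lookup t i

Distinct : Color → Color → Color → Set
Distinct a b c = a ≢ b × b ≢ c × a ≢ c

distinct? : ∀ a b c → Dec (Distinct a b c)
distinct? a b c = ¬? (a ≟ b) ×-dec ¬? (b ≟ c) ×-dec ¬? (a ≟ c)

distinct⇒injective : ∀ {a b c} → Distinct a b c → Injective _≡_ _≡_ (lookup (a ∷ b ∷ c ∷ []))
distinct⇒injective (a≢b , b≢c , a≢c) {0F} {0F} _ = refl
distinct⇒injective (a≢b , b≢c , a≢c) {0F} {1F} p = contradiction p a≢b
distinct⇒injective (a≢b , b≢c , a≢c) {0F} {2F} p = contradiction p a≢c
distinct⇒injective (a≢b , b≢c , a≢c) {1F} {0F} p = contradiction (sym p) a≢b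
distinct⇒injective (a≢b , b≢c , a≢c) {1F} {1F} _ = refl
distinct⇒injective (a≢b , b≢c , a≢c) {1F} {2F} p = contradiction p b≢c
distinct⇒injective (a≢b , b≢c , a≢c) {2F} {0F} p = contradiction (sym p) a≢c
distinct⇒injective (a≢b , b≢c , a≢c) {2F} {1F} p = contradiction (sym p) b≢c
distinct⇒injective (a≢b , b≢c , a≢c) {2F} {2F} _ = refl

-- Only a lower bound on the states: each operation below has to produce colorings, never to
-- classify them.
Realizable : Pred (Vec Color m) 0ℓ → Set
Realizable {m} P = ∃[ M ] (∀ {t} → P t → State {m} M t)

realizable-⊆ : {P Q : Pred (Vec Color m) 0ℓ} → (∀ t → Q t → P t) → Realizable P → Realizable Q
realizable-⊆ Q⊆P (M , states) = M , λ {t} q → states (Q⊆P t q)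

-- Operations on poles.

realizable-empty : Realizable (λ (_ : Vec Color 0) → ⊤)
realizable-empty = record
  { vertices = 0
  ; edges    = 0
  ; place    = mk↔ₛ′ (λ { (inj₁ (() , _)) ; (inj₂ ()) }) (λ { (() , _) })
                     (λ { (() , _) }) (λ { (inj₁ (() , _)) ; (inj₂ ()) })
  } , λ _ → record { color = λ { (() , _) } ; distinct = λ () ; edge = λ () ; semiedge = λ () }

-- Disjoint union with a single vertex, whose semiedges come first; attaching it to the rest is left
-- to `realizable-join`.
WithVertex : Pred (Vec Color m) 0ℓ → Pred (Vec Color (3 + m)) 0ℓ
WithVertex P (a ∷ b ∷ c ∷ t) = Distinct a b c × P t

realizable-vertex : {P : Pred (Vec Color m) 0ℓ} → Realizable P → Realizable (WithVertex P)
realizable-vertex {m} {P} (M , states) = M⁺ , states⁺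
  where
  open Pole M

  split : Slot edges (3 + m) ↔ (Slot edges m ⊎ Fin 3)
  split = mk↔ₛ′
    (λ { (inj₁ s) → inj₁ (inj₁ s)
       ; (inj₂ 0F) → inj₂ 0F ; (inj₂ 1F) → inj₂ 1F ; (inj₂ 2F) → inj₂ 2F
       ; (inj₂ (suc (suc (suc i)))) → inj₁ (inj₂ i) })
    (λ { (inj₁ (inj₁ s)) → inj₁ s ; (inj₁ (inj₂ i)) → inj₂ (3 ↑ʳ i) ; (inj₂ k) → inj₂ (k ↑ˡ m) })
    (λ { (inj₁ (inj₁ s)) → refl ; (inj₁ (inj₂ i)) → refl
       ; (inj₂ 0F) → refl ; (inj₂ 1F) → refl ; (inj₂ 2F) → refl })
    (λ { (inj₁ s) → refl
       ; (inj₂ 0F) → refl ; (inj₂ 1F) → refl ; (inj₂ 2F) → refl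
       ; (inj₂ (suc (suc (suc i)))) → refl })

  adjoin : ((Fin vertices × Fin 3) ⊎ Fin 3) ↔ (Fin (suc vertices) × Fin 3)
  adjoin = mk↔ₛ′
    (λ { (inj₁ (v , k)) → suc v , k ; (inj₂ k) → zero , k })
    (λ { (zero , k) → inj₂ k ; (suc v , k) → inj₁ (v , k) })
    (λ { (zero , k) → refl ; (suc v , k) → refl })
    (λ { (inj₁ (v , k)) → refl ; (inj₂ k) → refl })

  M⁺ : Pole (3 + m)
  M⁺ = record
    { vertices = suc vertices
    ; edges    = edges
    ; place    = adjoin ↔-∘ ((place ⊎-↔ ↔-id (Fin 3)) ↔-∘ split)
    }

  states⁺ : ∀ {t} → WithVertex P t → State M⁺ t
  states⁺ {a ∷ b ∷ c ∷ t} (abc , p) = record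
    { color    = λ { (zero , k) → lookup (a ∷ b ∷ c ∷ []) k ; (suc v , k) → S.color (v , k) }
    ; distinct = λ { zero → distinct⇒injective abc ; (suc v) → S.distinct v }
    ; edge     = S.edge
    ; semiedge = λ { 0F → refl ; 1F → refl ; 2F → refl ; (suc (suc (suc i))) → S.semiedge i }
    }
    where module S = State (states p)

-- The witness `c` is the color of the new edge. Other pairs of semiedges are joined after
-- `realizable-pull` has brought them to the front.
realizable-join : {P : Pred (Vec Color (2 + m)) 0ℓ} → Realizable P →
                  Realizable (λ t → ∃[ c ] P (c ∷ c ∷ t))
realizable-join {m} {P} (M , states) = M⁺ , states⁺
  where
  open Pole M

  close : Slot (suc edges) m ↔ Slot edges (2 + m)
  close = mk↔ₛ′
    (λ { (inj₁ (zero , false)) → inj₂ 0F ; (inj₁ (zero , true)) → inj₂ 1F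
       ; (inj₁ (suc e , b)) → inj₁ (e , b) ; (inj₂ i) → inj₂ (2 ↑ʳ i) })
    (λ { (inj₁ (e , b)) → inj₁ (suc e , b) ; (inj₂ 0F) → inj₁ (zero , false)
       ; (inj₂ 1F) → inj₁ (zero , true) ; (inj₂ (suc (suc i))) → inj₂ i })
    (λ { (inj₁ _) → refl ; (inj₂ 0F) → refl ; (inj₂ 1F) → refl ; (inj₂ (suc (suc _))) → refl })
    (λ { (inj₁ (zero , false)) → refl ; (inj₁ (zero , true)) → refl
       ; (inj₁ (suc _ , _)) → refl ; (inj₂ _) → refl })

  M⁺ : Pole m
  M⁺ = record { vertices = vertices ; edges = suc edges ; place = place ↔-∘ close }

  states⁺ : ∀ {t} → (∃[ c ] P (c ∷ c ∷ t)) → State M⁺ t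
  states⁺ (c , p) = record
    { color    = S.color
    ; distinct = S.distinct
    ; edge     = λ { zero → trans (S.semiedge 0F) (sym (S.semiedge 1F)) ; (suc e) → S.edge e }
    ; semiedge = λ i → S.semiedge (2 ↑ʳ i)
    }
    where module S = State (states p)

Pulled : Fin (suc m) → Pred (Vec Color (suc m)) 0ℓ → Pred (Vec Color (suc m)) 0ℓ
Pulled i P (c ∷ t) = P (insertAt t i c)

realizable-pull : ∀ i {P : Pred (Vec Color (suc m)) 0ℓ} → Realizable P → Realizable (Pulled i P)
realizable-pull {m} i {P} (M , states) = M⁺ , states⁺
  where
  open Pole M

  -- `π` sends `zero` to `i` and `suc j` to `punchIn i j`, as `insertAt` moves positions.
  π : Fin (suc m) ↔ Fin (suc m)
  π = insert zero i (↔-id (Fin m))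

  M⁺ : Pole (suc m)
  M⁺ = record
    { vertices = vertices
    ; edges    = edges
    ; place    = place ↔-∘ (↔-id (Fin edges × Bool) ⊎-↔ π)
    }

  lookup-π : ∀ c t j → lookup (insertAt t i c) (π ⟨$⟩ʳ j) ≡ lookup (c ∷ t) j
  lookup-π c t zero    = insertAt-lookup t i c
  lookup-π c t (suc j) =
    trans (cong (lookup (insertAt t i c)) (insert-punchIn zero i (↔-id (Fin m)) j))
          (insertAt-punchIn t i c j)

  states⁺ : ∀ {t} → Pulled i P t → State M⁺ t
  states⁺ {c ∷ t} p = record
    { color    = S.color
    ; distinct = S.distinct
    ; edge     = S.edge
    ; semiedge = λ j → trans (S.semiedge (π ⟨$⟩ʳ j)) (lookup-π c t j)
    }
    where module S = State (states p)

-- Semiedge `i` becomes an edge of color `p` to a new vertex, which carries the two leading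
-- semiedges.
Sprouted : Fin (suc m) → Pred (Vec Color (suc m)) 0ℓ → Pred (Vec Color (2 + m)) 0ℓ
Sprouted i P (a ∷ b ∷ t) = ∃[ p ] Distinct p a b × P (insertAt t i p)

realizable-sprout : ∀ i {P : Pred (Vec Color (suc m)) 0ℓ} →
                    Realizable P → Realizable (Sprouted i P)
realizable-sprout i =
  realizable-⊆ (λ { (a ∷ b ∷ t) q → q })
  -- The shift by 3 skips the semiedges of the new vertex, the first of which is then joined to the
  -- old semiedge `i`.
  ∘ realizable-join ∘ realizable-pull (3 ↑ʳ i) ∘ realizable-vertex

-- Two semiedges become edges to one new vertex. Here `j` counts among the semiedges left after
-- removing `i`.
Merged : Fin (2 + m) → Fin (suc m) → Pred (Vec Color (2 + m)) 0ℓ → Pred (Vec Color (suc m)) 0ℓ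
Merged i j P (a ∷ t) = ∃[ q ] ∃[ p ] Distinct p q a × P (insertAt (insertAt t j q) i p)

realizable-merge : ∀ i j {P : Pred (Vec Color (2 + m)) 0ℓ} →
                   Realizable P → Realizable (Merged i j P)
realizable-merge i j =
  realizable-⊆ (λ { (a ∷ t) q → q })
  -- The two skipped semiedges are those sprouted; the first is joined to `j`, the second remains as
  -- `a`.
  ∘ realizable-join ∘ realizable-pull (2 ↑ʳ j) ∘ realizable-sprout i

-- Admissibility as a vanishing sum in the Klein four-group.

-- Fin 4 is the Klein four-group with identity 0F, and act i adds the nonzero element i + 1.
act : Color → Fin 4 → Fin 4
act 0F = lookup (1F ∷ 0F ∷ 3F ∷ 2F ∷ [])
act 1F = lookup (2F ∷ 3F ∷ 0F ∷ 1F ∷ [])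
act 2F = lookup (3F ∷ 2F ∷ 1F ∷ 0F ∷ [])

charge : Vec Color m → Fin 4
charge = foldr′ act 0F

act-comm : ∀ c d s → act c (act d s) ≡ act d (act c s)
act-comm = from-yes (all? λ c → all? λ d → all? λ s → act c (act d s) ≟ act d (act c s))

act-involutive : ∀ c s → act c (act c s) ≡ s
act-involutive = from-yes (all? λ c → all? λ s → act c (act c s) ≟ s)

act^ : Color → ℕ → Fin 4 → Fin 4
act^ c n s = fold s (act c) n

act^-comm : ∀ c d n s → act^ c n (act d s) ≡ act d (act^ c n s)
act^-comm c d zero    s = refl
act^-comm c d (suc n) s = trans (cong (act c) (act^-comm c d n s)) (act-comm c d (act^ c n s))

act^-% : ∀ c n s → act^ c n s ≡ act^ c (n % 2) s
act^-% c 0             s = refl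
act^-% c 1             s = refl
act^-% c (suc (suc n)) s = trans (act-involutive c (act^ c n s)) (act^-% c n s)

-- By commutativity each head entry moves past the blocks of smaller colors, which sorts the sum by
-- color.
charge-count : (t : Vec Color m) →
  charge t ≡ act^ 0F (count (_≟ 0F) t) (act^ 1F (count (_≟ 1F) t) (act^ 2F (count (_≟ 2F) t) 0F))
charge-count []       = refl
charge-count (0F ∷ t) = cong (act 0F) (charge-count t)
charge-count (1F ∷ t) = trans (cong (act 1F) (charge-count t))
  (sym (act^-comm 0F 1F (count (_≟ 0F) t) _))
charge-count (2F ∷ t) = trans (cong (act 2F) (charge-count t))
  (trans (sym (act^-comm 0F 2F (count (_≟ 0F) t) _))
         (cong (act^ 0F (count (_≟ 0F) t)) (sym (act^-comm 1F 2F (count (_≟ 1F) t) _))))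

act^-cancel : ∀ {k} → k < 2 → act^ 0F k (act^ 1F k (act^ 2F k 0F)) ≡ 0F
act^-cancel z<s       = refl
act^-cancel (s<s z<s) = refl

-- Stands in for admissibility in the induction, because the tail of a tuple enters it only through
-- an element of `Fin 4`.
Neutral : Pred (Vec Color m) 0ℓ
Neutral t = charge t ≡ 0F

-- Every element is its own inverse, so the counts matter only modulo 2. They share the parity `k`,
-- and the three nonzero elements sum to zero.
admissible⇒neutral : (t : Vec Color m) → Admissible t → Neutral t
admissible⇒neutral {m} t adm = begin
  charge t                                 ≡⟨ charge-count t ⟩
  act^ 0F n₀ (act^ 1F n₁ (act^ 2F n₂ 0F))  ≡⟨ cong (act^ 0F n₀ ∘ act^ 1F n₁) (parity 2F 0F) ⟩
  act^ 0F n₀ (act^ 1F n₁ (act^ 2F k 0F))   ≡⟨ cong (act^ 0F n₀) (parity 1F _) ⟩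
  act^ 0F n₀ (act^ 1F k (act^ 2F k 0F))    ≡⟨ parity 0F _ ⟩
  act^ 0F k (act^ 1F k (act^ 2F k 0F))     ≡⟨ act^-cancel (m%n<n m 2) ⟩
  0F                                       ∎
  where
  open ≡-Reasoning
  k  = m % 2
  n₀ = count (_≟ 0F) t
  n₁ = count (_≟ 1F) t
  n₂ = count (_≟ 2F) t
  parity : ∀ c s → act^ c (count (_≟ c) t) s ≡ act^ c k s
  parity c s = trans (act^-% c (count (_≟ c) t) s) (cong (λ r → act^ c r s) (adm c))

-- Realizing all neutral tuples.

realizable-2-pole : Realizable (Neutral {2})
realizable-2-pole =
  realizable-⊆ (λ { (a ∷ c ∷ []) neutral → two-vertices a c neutral })
    -- Two vertices joined by parallel edges, with one semiedge each: the same states as a free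
    -- edge, which `Pole` excludes.
    (realizable-merge 0F 0F (realizable-vertex realizable-empty))
  where
  two-vertices : ∀ a c → Neutral (a ∷ c ∷ []) →
                 ∃[ q ] ∃[ p ] Distinct p q a × Distinct p q c × ⊤
  two-vertices = from-yes (all? λ a → all? λ c → (act a (act c 0F) ≟ 0F) →-dec
    any? λ q → any? λ p → distinct? p q a ×-dec distinct? p q c ×-dec yes _)

realizable-suc : Realizable (Neutral {2 + m}) → Realizable (Neutral {3 + m})
realizable-suc {m} =
  realizable-⊆ (λ { (d ∷ e ∷ c ∷ t) neutral → seven-vertices d e c (charge t) neutral })
  ∘ four-cycle ∘ path
  where
  Path : Pred (Vec Color (3 + m)) 0ℓ
  -- The sprouts turn `p , q` into `y , c , x , a`; merging `y` with `x` leaves `b , c , a` before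
  -- the tail.
  Path = Merged 0F 1F (Sprouted 2F (Sprouted 0F Neutral))

  path : Realizable (Neutral {2 + m}) → Realizable Path
  path = realizable-merge 0F 1F ∘ realizable-sprout 2F ∘ realizable-sprout 0F

  four-cycle : {P : Pred (Vec Color (3 + m)) 0ℓ} → Realizable P →
               Realizable (Merged 2F 1F (Merged 0F 1F (Sprouted 3F (Sprouted 0F P))))
  -- From `b , c , a` the orders are `e₁ , e₂ , c , a`, then `e₃ , e₄ , e₁ , e₂ , c`, then
  -- `e , e₄ , e₂ , c`, then `d , e , c`.
  four-cycle = realizable-merge 2F 1F ∘ realizable-merge 0F 1F
               ∘ realizable-sprout 3F ∘ realizable-sprout 0F

  -- A finite search, `s` being the charge of the tail. The quantifiers follow the nested predicates
  -- from the outside in: four triples for the cycle, then three for the path.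
  seven-vertices : ∀ d e c s → act d (act e (act c s)) ≡ 0F →
    ∃[ e₄ ] ∃[ e₂ ] Distinct e₂ e₄ d ×
    ∃[ e₁ ] ∃[ e₃ ] Distinct e₃ e₁ e ×
    ∃[ a ] Distinct a e₃ e₄ ×
    ∃[ b ] Distinct b e₁ e₂ ×
    ∃[ x ] ∃[ y ] Distinct y x b ×
    ∃[ q ] Distinct q y c ×
    ∃[ p ] Distinct p x a ×
    act p (act q s) ≡ 0F
  seven-vertices = from-yes (all? λ d → all? λ e → all? λ c → all? λ s →
    (act d (act e (act c s)) ≟ 0F) →-dec
    any? λ e₄ → any? λ e₂ → distinct? e₂ e₄ d ×-dec
    any? λ e₁ → any? λ e₃ → distinct? e₃ e₁ e ×-dec
    any? λ a → distinct? a e₃ e₄ ×-dec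
    any? λ b → distinct? b e₁ e₂ ×-dec
    any? λ x → any? λ y → distinct? y x b ×-dec
    any? λ q → distinct? q y c ×-dec
    any? λ p → distinct? p x a ×-dec
    (act p (act q s) ≟ 0F))

realizable-neutral : ∀ m → Realizable (Neutral {2 + m})
realizable-neutral zero    = realizable-2-pole
realizable-neutral (suc m) = realizable-suc (realizable-neutral m)

-- From poles to multipoles.

module _ (P : Pole m) where
  open Pole P

  private
    -- `IncidentAt` of the later `multipole`, written out because `cubic` must be supplied to build
    -- it.
    At : Fin vertices → Set
    At v = (∃[ e ] proj₁ (to place (inj₁ (e , false))) ≡ v)
         ⊎ (∃[ e ] proj₁ (to place (inj₁ (e , true))) ≡ v)
         ⊎ (∃[ i ] inj₁ {B = Fin m} (proj₁ (to place (inj₂ i))) ≡ inj₁ v)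

    slot : ∀ {v} → At v → Slot edges m
    slot (inj₁ (e , _))        = inj₁ (e , false)
    slot (inj₂ (inj₁ (e , _))) = inj₁ (e , true)
    slot (inj₂ (inj₂ (i , _))) = inj₂ i

    slot-at : ∀ {v} (h : At v) → proj₁ (to place (slot h)) ≡ v
    slot-at (inj₁ (_ , p))        = p
    slot-at (inj₂ (inj₁ (_ , p))) = p
    slot-at (inj₂ (inj₂ (_ , p))) = inj₁-injective p

    at : ∀ {v} x → proj₁ (to place x) ≡ v → At v
    at (inj₁ (e , false)) p = inj₁ (e , p)
    at (inj₁ (e , true))  p = inj₂ (inj₁ (e , p))
    at (inj₂ i)           p = inj₂ (inj₂ (i , cong inj₁ p))

    slot∘at : ∀ {v} x (p : proj₁ (to place x) ≡ v) → slot (at x p) ≡ x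
    slot∘at (inj₁ (e , false)) p = refl
    slot∘at (inj₁ (e , true))  p = refl
    slot∘at (inj₂ i)           p = refl

    -- `x` stays a variable so that both equations can be matched with `refl`; in use it is an image
    -- under `from place`, equal to `slot h` only propositionally.
    at∘slot : ∀ {v} (h : At v) x (p : proj₁ (to place x) ≡ v) → x ≡ slot h → at x p ≡ h
    at∘slot (inj₁ (e , refl))        _ refl refl = refl
    at∘slot (inj₂ (inj₁ (e , refl))) _ refl refl = refl
    at∘slot (inj₂ (inj₂ (i , refl))) _ refl refl = refl

    index : ∀ {v} → At v → Fin 3
    index h = proj₂ (to place (slot h))

    place-slot : ∀ {v} (h : At v) → to place (slot h) ≡ (v , index h)
    place-slot h = cong (_, index h) (slot-at h)

    At↔Fin3 : ∀ v → At v ↔ Fin 3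
    At↔Fin3 v = mk↔ₛ′ index fromIndex
      (λ k → trans (cong (proj₂ ∘ to place) (slot∘at (from place (v , k)) _))
                   (cong proj₂ (strictlyInverseˡ place (v , k))))
      (λ h → at∘slot h _ _
        (trans (cong (from place) (sym (place-slot h))) (strictlyInverseʳ place (slot h))))
      where
      fromIndex : Fin 3 → At v
      fromIndex k = at (from place (v , k)) (cong proj₁ (strictlyInverseˡ place (v , k)))

  multipole : Multipole m
  multipole = record
    { V        = Fin vertices
    ; E        = Fin edges
    ; V-finite = vertices , ↔-id _
    ; E-finite = edges , ↔-id _
    ; ends     = λ e → proj₁ (to place (inj₁ (e , false))) , proj₁ (to place (inj₁ (e , true)))
    ; attach   = λ i → inj₁ (proj₁ (to place (inj₂ i)))
    ; paired   = λ ()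
    ; cubic    = At↔Fin3
    }

  state⇒isState : ∀ {t} → State P t → IsState multipole t
  state⇒isState {t} S = record
    { φᴱ     = φᴱ
    ; φˢ     = lookup t
    -- Equal colors give equal indices by `distinct`, and an index determines its incidence.
    ; proper = λ v {h} {h′} eq → trans (sym (strictlyInverseʳ (At↔Fin3 v) h))
        (trans (cong (from (At↔Fin3 v)) (distinct v
          (trans (color-index h) (trans eq (sym (color-index h′))))))
        (strictlyInverseʳ (At↔Fin3 v) h′))
    ; free   = λ ()
    } , tabulate∘lookup t
    where
    open State S

    φᴱ : Fin edges → Color
    φᴱ e = color (to place (inj₁ (e , false)))

    color-slot : ∀ {v} (h : At v) →
                 color (to place (slot h)) ≡ colorAt multipole φᴱ (lookup t) v h
    color-slot (inj₁ (e , _))        = refl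
    color-slot (inj₂ (inj₁ (e , _))) = sym (edge e)
    color-slot (inj₂ (inj₂ (i , _))) = semiedge i

    color-index : ∀ {v} (h : At v) →
                  color (v , index h) ≡ colorAt multipole φᴱ (lookup t) v h
    color-index h = trans (cong color (sym (place-slot h))) (color-slot h)

mainTheorem3 : (m : ℕ) → 2 ≤ m → ∃[ M ] ColorComplete {m} M
mainTheorem3 (suc (suc m)) (s≤s (s≤s z≤n)) =
  let P , states = realizable-neutral m
  in multipole P , λ t adm → state⇒isState P (states (admissible⇒neutral t adm))
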